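{- For every integer $n\ge 1$, the set $H_n\subseteq\mathbb{R}^{2^n-1}$ is a cone of dimension $2^n-1$ (i.e. it is full-dimensional).
   Context: For a positive integer $k$ let $[k]=\{1,\dots,k\}$. $K_N$ is the undirected complete graph on vertex set $[N]$, with edge set $E_N=\{(i,j):1\le i<j\le N\}$. A weight map is a function $w:E_N\to\mathbb{R}_{\ge 0}$. For $W\subseteq[N]$, the cut $C(W)$ is the set of edges with exactly one endpoint in $W$, and $\|C(W)\|$ is the sum of the weights of its edges. For integers $1\le n<N$, the vertices in $[n]$ of $K_N$ are called terminals, vertex $N$ is the sink, and the remaining vertices are bulk vertices. Given $w$ on $K_N$, for each $\varnothing\ne I\subseteq[n]$ set $$S_I=\min\{\|C(W)\| : W\subseteq[N-1],\ W\cap[n]=I\}.$$ The resulting vector $S=(S_I)_{\varnothing\ne I\subseteq[n]}\in\mathbb{R}^{2^n-1}$ is said to be realized by $w$ in $K_N$, and $(S,w)$ is called a valid pair. The holographic entropy cone is $H_n=\{S\in\mathbb{R}^{2^n-1} : (S,w)\text{ is a valid pair for some } N>n \text{ and some weight map } w \text{ on } K_N\}$. A cone is a set closed under multiplication by positive scalars; its dimension is the dimension of its linear span. -}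

module Defs where

open import Algebra.Bundles.Raw using (RawMonoid)
import Algebra.Definitions.RawMonoid as RawMonoidDefinitions
open import Data.Bool using (Bool; _xor_; if_then_else_)
import Data.Bool.Properties as Bool
open import Data.Fin using (Fin; fromℕ; _<_; _<?_)
open import Data.Fin.Subset using (Subset; Nonempty; _∉_; inside; outside)
open import Data.Fin.Subset.Properties using (_∈?_)
open import Data.Irrelevant using ([_])
open import Data.List using (List; []; _∷_; _++_; map; filter; foldr)
open import Data.Nat as ℕ using (ℕ; zero; suc; z≤n; s≤s)
import Data.Nat.Properties as ℕ
open import Data.Product using (∃; ∃-syntax; Σ-syntax; _×_; _,_; proj₁; proj₂)
open import Data.Rational as ℚ using (ℚ; 0ℚ; 1ℚ; ½; ∣_∣)
import Data.Rational.Properties as ℚ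
open import Data.Rational.Solver using (module +-*-Solver)
open import Data.Refinement using (Refinement-syntax; value) renaming (_,_ to _,ᵣ_)
open import Data.Sum using (inj₁; inj₂)
open import Data.Vec using (_∷_; []; lookup; truncate; padRight)
open import Data.Vec.Properties using (≡-dec; truncate-padRight; lookup-replicate; []=⇒lookup)
open import Level using (0ℓ)
open import Relation.Binary.PropositionalEquality
  using (_≡_; refl; sym; trans; cong; cong₂; subst)
open import Relation.Nullary using (yes; no; ¬?)
open import Relation.Nullary.Decidable using (_×-dec_)
open import Relation.Unary using (Pred; Decidable; _∈_)

private
  p≤∣p∣ : ∀ p → p ℚ.≤ ∣ p ∣
  p≤∣p∣ p with ℚ.≤-total 0ℚ p
  ... | inj₁ 0≤p = ℚ.≤-reflexive (sym (ℚ.0≤p⇒∣p∣≡p 0≤p))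
  ... | inj₂ p≤0 = ℚ.≤-trans p≤0 (ℚ.0≤∣p∣ p)

  close⇒< : ∀ {p q ε} → ∣ p ℚ.- q ∣ ℚ.< ε → p ℚ.< q ℚ.+ ε
  close⇒< {p} {q} {ε} d =
    subst (ℚ._< q ℚ.+ ε) (solve 2 (λ p q → q :+ (p :- q) := p) refl p q)
      (ℚ.+-monoʳ-< q {p ℚ.- q} {ε} (ℚ.≤-<-trans (p≤∣p∣ (p ℚ.- q)) d))
    where open +-*-Solver

  <⇒difference< : ∀ {p q ε} → p ℚ.< q ℚ.+ ε → p ℚ.- q ℚ.< ε
  <⇒difference< {p} {q} {ε} h =
    subst (p ℚ.- q ℚ.<_) (solve 2 (λ q ε → (q :+ ε) :- q := ε) refl q ε)
      (ℚ.+-monoˡ-< (ℚ.- q) {p} {q ℚ.+ ε} h)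
    where open +-*-Solver

  <⇒close : ∀ {p q ε} → p ℚ.< q ℚ.+ ε → q ℚ.< p ℚ.+ ε → ∣ p ℚ.- q ∣ ℚ.< ε
  <⇒close {p} {q} {ε} h₁ h₂ with ℚ.∣p∣≡p∨∣p∣≡-p (p ℚ.- q)
  ... | inj₁ eq = subst (ℚ._< ε) (sym eq) (<⇒difference< {p} {q} h₁)
  ... | inj₂ eq = subst (ℚ._< ε)
          (sym (trans eq (solve 2 (λ p q → :- (p :- q) := q :- p) refl p q)))
          (<⇒difference< {q} {p} h₂)
    where open +-*-Solver

  ⊓-<-+ : ∀ {p q p′ q′ ε} → p ℚ.< p′ ℚ.+ ε → q ℚ.< q′ ℚ.+ ε →
          p ℚ.⊓ q ℚ.< (p′ ℚ.⊓ q′) ℚ.+ ε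
  ⊓-<-+ {p} {q} {p′} {q′} {ε} h₁ h₂ with ℚ.⊓-sel p′ q′
  ... | inj₁ eq = subst (λ z → p ℚ.⊓ q ℚ.< z ℚ.+ ε) (sym eq)
                    (ℚ.≤-<-trans (ℚ.p⊓q≤p p q) h₁)
  ... | inj₂ eq = subst (λ z → p ℚ.⊓ q ℚ.< z ℚ.+ ε) (sym eq)
                    (ℚ.≤-<-trans (ℚ.p⊓q≤q p q) h₂)

  half : ∀ {ε} → 0ℚ ℚ.< ε → 0ℚ ℚ.< ½ ℚ.* ε
  half {ε} 0<ε = subst (ℚ._< ½ ℚ.* ε) (ℚ.*-zeroʳ ½) (ℚ.*-monoʳ-<-pos ½ 0<ε)

  half+half : ∀ ε → ½ ℚ.* ε ℚ.+ ½ ℚ.* ε ≡ ε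
  half+half ε = trans (sym (ℚ.*-distribʳ-+ ε ½ ½)) (ℚ.*-identityˡ ε)

  divide : ∀ {K ε} → 0ℚ ℚ.< K → 0ℚ ℚ.< ε →
           ∃[ δ ] 0ℚ ℚ.< δ × K ℚ.* δ ≡ ε
  divide {K} {ε} 0<K 0<ε = δ , 0<δ , K*δ≡ε
    where
    instance
      K-pos : ℚ.Positive K
      K-pos = ℚ.positive 0<K
      K-nonZero : ℚ.NonZero K
      K-nonZero = ℚ.pos⇒nonZero K
      1/K-pos : ℚ.Positive (ℚ.1/ K)
      1/K-pos = ℚ.1/pos⇒pos K
    δ = ℚ.1/ K ℚ.* ε
    0<δ : 0ℚ ℚ.< δ
    0<δ = subst (ℚ._< δ) (ℚ.*-zeroʳ (ℚ.1/ K)) (ℚ.*-monoʳ-<-pos (ℚ.1/ K) 0<ε)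
    K*δ≡ε : K ℚ.* δ ≡ ε
    K*δ≡ε = trans (sym (ℚ.*-assoc K (ℚ.1/ K) ε))
           (trans (cong (ℚ._* ε) (ℚ.*-inverseʳ K)) (ℚ.*-identityˡ ε))

  product-bound : ∀ {p q B δ} → ∣ p ∣ ℚ.≤ B → ∣ q ∣ ℚ.≤ δ → ∣ p ℚ.* q ∣ ℚ.≤ B ℚ.* δ
  product-bound {p} {q} {B} {δ} p≤B q≤δ = begin
    ∣ p ℚ.* q ∣      ≡⟨ ℚ.∣p*q∣≡∣p∣*∣q∣ p q ⟩
    ∣ p ∣ ℚ.* ∣ q ∣  ≤⟨ ℚ.*-monoʳ-≤-nonNeg ∣ q ∣ {{ℚ.∣-∣-nonNeg q}} p≤B ⟩
    B ℚ.* ∣ q ∣      ≤⟨ ℚ.*-monoˡ-≤-nonNeg B {{ℚ.nonNegative 0≤B}} q≤δ ⟩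
    B ℚ.* δ          ∎
    where
    open ℚ.≤-Reasoning
    0≤B = ℚ.≤-trans (ℚ.0≤∣p∣ p) p≤B

-- The real numbers are constructed as Cauchy sequences of rationals.
IsCauchy : (ℕ → ℚ) → Set
IsCauchy x = ∀ ε → 0ℚ ℚ.< ε →
  ∃[ N ] (∀ m n → N ℕ.≤ m → N ℕ.≤ n → ∣ x m ℚ.- x n ∣ ℚ.< ε)

record ℝ : Set where
  constructor mkℝ
  field
    seq    : ℕ → ℚ
    cauchy : IsCauchy seq

open ℝ public

Eventually : Pred ℕ 0ℓ → Set
Eventually P = ∃[ N ] (∀ n → N ℕ.≤ n → P n)

-- ℝ is a setoid: _≈ᵣ_, rather than _≡_, is equality of real numbers.
infix 4 _≈ᵣ_ _≤ᵣ_ _<ᵣ_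

_≈ᵣ_ : ℝ → ℝ → Set
x ≈ᵣ y = ∀ ε → 0ℚ ℚ.< ε → Eventually λ n → ∣ seq x n ℚ.- seq y n ∣ ℚ.< ε

_≤ᵣ_ : ℝ → ℝ → Set
x ≤ᵣ y = ∀ ε → 0ℚ ℚ.< ε → Eventually λ n → seq x n ℚ.≤ seq y n ℚ.+ ε

_<ᵣ_ : ℝ → ℝ → Set
x <ᵣ y = ∃[ ε ] 0ℚ ℚ.< ε × Eventually λ n → seq x n ℚ.+ ε ℚ.≤ seq y n

fromℚ : ℚ → ℝ
fromℚ q = mkℝ (λ _ → q) λ ε 0<ε →
  0 , λ _ _ _ _ → subst (ℚ._< ε) (cong ∣_∣ (sym (ℚ.+-inverseʳ q))) 0<ε

0ᵣ : ℝ
0ᵣ = fromℚ 0ℚ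

infixl 6 _+ᵣ_
infixl 7 _*ᵣ_ _⊓ᵣ_

_+ᵣ_ : ℝ → ℝ → ℝ
mkℝ x cx +ᵣ mkℝ y cy = mkℝ (λ n → x n ℚ.+ y n) λ ε 0<ε →
  let (M , x-close) = cx (½ ℚ.* ε) (half {ε} 0<ε)
      (N , y-close) = cy (½ ℚ.* ε) (half {ε} 0<ε)
  in M ℕ.⊔ N , λ m n ≤m ≤n → begin-strict
       ∣ (x m ℚ.+ y m) ℚ.- (x n ℚ.+ y n) ∣
         ≡⟨ cong ∣_∣ (regroup (x m) (y m) (x n) (y n)) ⟩
       ∣ (x m ℚ.- x n) ℚ.+ (y m ℚ.- y n) ∣
         ≤⟨ ℚ.∣p+q∣≤∣p∣+∣q∣ (x m ℚ.- x n) (y m ℚ.- y n) ⟩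
       ∣ x m ℚ.- x n ∣ ℚ.+ ∣ y m ℚ.- y n ∣
         <⟨ ℚ.+-mono-< {∣ x m ℚ.- x n ∣} {½ ℚ.* ε} {∣ y m ℚ.- y n ∣} {½ ℚ.* ε}
              (x-close m n (ℕ.m⊔n≤o⇒m≤o M N ≤m) (ℕ.m⊔n≤o⇒m≤o M N ≤n))
              (y-close m n (ℕ.m⊔n≤o⇒n≤o M N ≤m) (ℕ.m⊔n≤o⇒n≤o M N ≤n)) ⟩
       ½ ℚ.* ε ℚ.+ ½ ℚ.* ε
         ≡⟨ half+half ε ⟩
       ε ∎
  where
  open ℚ.≤-Reasoning
  regroup : ∀ a b c d → (a ℚ.+ b) ℚ.- (c ℚ.+ d) ≡ (a ℚ.- c) ℚ.+ (b ℚ.- d)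
  regroup = solve 4 (λ a b c d → (a :+ b) :- (c :+ d) := (a :- c) :+ (b :- d)) refl
    where open +-*-Solver

_⊓ᵣ_ : ℝ → ℝ → ℝ
mkℝ x cx ⊓ᵣ mkℝ y cy = mkℝ (λ n → x n ℚ.⊓ y n) λ ε 0<ε →
  let (M , x-close) = cx ε 0<ε
      (N , y-close) = cy ε 0<ε
      below : ∀ m n → M ℕ.⊔ N ℕ.≤ m → M ℕ.⊔ N ℕ.≤ n →
              x m ℚ.⊓ y m ℚ.< (x n ℚ.⊓ y n) ℚ.+ ε
      below m n ≤m ≤n = ⊓-<-+ {x m} {y m} {x n} {y n}
        (close⇒< {x m} {x n} (x-close m n (ℕ.m⊔n≤o⇒m≤o M N ≤m) (ℕ.m⊔n≤o⇒m≤o M N ≤n)))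
        (close⇒< {y m} {y n} (y-close m n (ℕ.m⊔n≤o⇒n≤o M N ≤m) (ℕ.m⊔n≤o⇒n≤o M N ≤n)))
  in M ℕ.⊔ N , λ m n ≤m ≤n →
       <⇒close {x m ℚ.⊓ y m} {x n ℚ.⊓ y n} (below m n ≤m ≤n) (below n m ≤n ≤m)

private
  eventually-bounded : ∀ x → IsCauchy x →
    ∃[ B ] 0ℚ ℚ.< B × Eventually λ n → ∣ x n ∣ ℚ.≤ B
  eventually-bounded x cx with cx 1ℚ (ℚ.positive⁻¹ 1ℚ)
  ... | N , close = ∣ x N ∣ ℚ.+ 1ℚ , 0<B , N , bounded
    where
    open ℚ.≤-Reasoning
    0<B : 0ℚ ℚ.< ∣ x N ∣ ℚ.+ 1ℚ
    0<B = ℚ.+-mono-≤-< {0ℚ} {∣ x N ∣} {0ℚ} {1ℚ} (ℚ.0≤∣p∣ (x N)) (ℚ.positive⁻¹ 1ℚ)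
    bounded : ∀ n → N ℕ.≤ n → ∣ x n ∣ ℚ.≤ ∣ x N ∣ ℚ.+ 1ℚ
    bounded n N≤n = begin
      ∣ x n ∣
        ≡⟨ cong ∣_∣ (solve 2 (λ p q → p := q :+ (p :- q)) refl (x n) (x N)) ⟩
      ∣ x N ℚ.+ (x n ℚ.- x N) ∣
        ≤⟨ ℚ.∣p+q∣≤∣p∣+∣q∣ (x N) (x n ℚ.- x N) ⟩
      ∣ x N ∣ ℚ.+ ∣ x n ℚ.- x N ∣
        ≤⟨ ℚ.+-monoʳ-≤ ∣ x N ∣ {∣ x n ℚ.- x N ∣} {1ℚ} (ℚ.<⇒≤ (close n N N≤n ℕ.≤-refl)) ⟩
      ∣ x N ∣ ℚ.+ 1ℚ ∎
      where open +-*-Solver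

private
  product-close : ∀ a b c d {A B α β} →
    ∣ a ∣ ℚ.≤ A → ∣ d ∣ ℚ.≤ B → ∣ b ℚ.- d ∣ ℚ.≤ α → ∣ a ℚ.- c ∣ ℚ.≤ β →
    ∣ a ℚ.* b ℚ.- c ℚ.* d ∣ ℚ.≤ A ℚ.* α ℚ.+ B ℚ.* β
  product-close a b c d {A} {B} {α} {β} a≤A d≤B b≈d a≈c = begin
    ∣ a ℚ.* b ℚ.- c ℚ.* d ∣
      ≡⟨ cong ∣_∣ (regroup a b c d) ⟩
    ∣ a ℚ.* (b ℚ.- d) ℚ.+ d ℚ.* (a ℚ.- c) ∣
      ≤⟨ ℚ.∣p+q∣≤∣p∣+∣q∣ (a ℚ.* (b ℚ.- d)) (d ℚ.* (a ℚ.- c)) ⟩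
    ∣ a ℚ.* (b ℚ.- d) ∣ ℚ.+ ∣ d ℚ.* (a ℚ.- c) ∣
      ≤⟨ ℚ.+-mono-≤ {∣ a ℚ.* (b ℚ.- d) ∣} {A ℚ.* α} {∣ d ℚ.* (a ℚ.- c) ∣} {B ℚ.* β}
           (product-bound {a} {b ℚ.- d} a≤A b≈d)
           (product-bound {d} {a ℚ.- c} d≤B a≈c) ⟩
    A ℚ.* α ℚ.+ B ℚ.* β ∎
    where
    open ℚ.≤-Reasoning
    regroup : ∀ a b c d →
      (a ℚ.* b) ℚ.- (c ℚ.* d) ≡ a ℚ.* (b ℚ.- d) ℚ.+ d ℚ.* (a ℚ.- c)
    regroup = solve 4 (λ a b c d → (a :* b) :- (c :* d) := a :* (b :- d) :+ d :* (a :- c)) refl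
      where open +-*-Solver

  split : ∀ {A B ε} → 0ℚ ℚ.< A → 0ℚ ℚ.< B → 0ℚ ℚ.< ε →
    ∃[ α ] ∃[ β ] 0ℚ ℚ.< α × 0ℚ ℚ.< β × A ℚ.* α ℚ.+ B ℚ.* β ℚ.< ε
  split {A} {B} {ε} 0<A 0<B 0<ε =
    let η = ½ ℚ.* ε
        0<η = half {ε} 0<ε
        (α , 0<α , Aα≡) = divide {A} {η} 0<A 0<η
        (β , 0<β , Bβ≡) = divide {B} {½ ℚ.* η} 0<B (half {η} 0<η)
    in α , β , 0<α , 0<β , (begin-strict
      A ℚ.* α ℚ.+ B ℚ.* β ≡⟨ cong₂ ℚ._+_ Aα≡ Bβ≡ ⟩
      η ℚ.+ ½ ℚ.* η       <⟨ ℚ.+-monoʳ-< η {½ ℚ.* η} {η} (smaller η 0<η) ⟩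
      η ℚ.+ η             ≡⟨ half+half ε ⟩
      ε                   ∎)
    where
    open ℚ.≤-Reasoning
    smaller : ∀ η → 0ℚ ℚ.< η → ½ ℚ.* η ℚ.< η
    smaller η 0<η = begin-strict
      ½ ℚ.* η             ≡⟨ ℚ.+-identityʳ (½ ℚ.* η) ⟨
      ½ ℚ.* η ℚ.+ 0ℚ      <⟨ ℚ.+-monoʳ-< (½ ℚ.* η) {0ℚ} {½ ℚ.* η} (half {η} 0<η) ⟩
      ½ ℚ.* η ℚ.+ ½ ℚ.* η ≡⟨ half+half η ⟩
      η                   ∎

_*ᵣ_ : ℝ → ℝ → ℝ
mkℝ x cx *ᵣ mkℝ y cy = mkℝ (λ n → x n ℚ.* y n) λ ε 0<ε →
  let (A , 0<A , K , x-bounded) = eventually-bounded x cx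
      (B , 0<B , L , y-bounded) = eventually-bounded y cy
      (α , β , 0<α , 0<β , small) = split {A} {B} {ε} 0<A 0<B 0<ε
      (M , y-close) = cy α 0<α
      (N , x-close) = cx β 0<β
  in (K ℕ.⊔ L) ℕ.⊔ (M ℕ.⊔ N) , λ m n ≤m ≤n →
    let K⊔L≤ : ∀ {k} → (K ℕ.⊔ L) ℕ.⊔ (M ℕ.⊔ N) ℕ.≤ k → K ℕ.⊔ L ℕ.≤ k
        K⊔L≤ = ℕ.m⊔n≤o⇒m≤o (K ℕ.⊔ L) (M ℕ.⊔ N)
        M⊔N≤ : ∀ {k} → (K ℕ.⊔ L) ℕ.⊔ (M ℕ.⊔ N) ℕ.≤ k → M ℕ.⊔ N ℕ.≤ k
        M⊔N≤ = ℕ.m⊔n≤o⇒n≤o (K ℕ.⊔ L) (M ℕ.⊔ N)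
        x-near = x-close m n (ℕ.m⊔n≤o⇒n≤o M N (M⊔N≤ ≤m)) (ℕ.m⊔n≤o⇒n≤o M N (M⊔N≤ ≤n))
        y-near = y-close m n (ℕ.m⊔n≤o⇒m≤o M N (M⊔N≤ ≤m)) (ℕ.m⊔n≤o⇒m≤o M N (M⊔N≤ ≤n))
    in ℚ.≤-<-trans
         (product-close (x m) (y m) (x n) (y n)
           (x-bounded m (ℕ.m⊔n≤o⇒m≤o K L (K⊔L≤ ≤m)))
           (y-bounded n (ℕ.m⊔n≤o⇒n≤o K L (K⊔L≤ ≤n)))
           (ℚ.<⇒≤ y-near) (ℚ.<⇒≤ x-near))
         small

ℝ≥0 : Set
ℝ≥0 = Σ[ x ∈ ℝ ] 0ᵣ ≤ᵣ x

+ᵣ-0-rawMonoid : RawMonoid 0ℓ 0ℓ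
+ᵣ-0-rawMonoid = record { Carrier = ℝ ; _≈_ = _≈ᵣ_ ; _∙_ = _+ᵣ_ ; ε = 0ᵣ }

open RawMonoidDefinitions +ᵣ-0-rawMonoid public using (sum)

module _ {X : Set} where

  infix 4 _≋_
  infixr 7 _·_

  _≋_ : (X → ℝ) → (X → ℝ) → Set
  u ≋ v = ∀ x → u x ≈ᵣ v x

  𝟘 : X → ℝ
  𝟘 _ = 0ᵣ

  _·_ : ℝ → (X → ℝ) → (X → ℝ)
  (c · v) x = c *ᵣ v x

  linearCombination : ∀ {k} → (Fin k → ℝ) → (Fin k → X → ℝ) → (X → ℝ)
  linearCombination c b x = sum λ j → c j *ᵣ b j x

  Span : Pred (X → ℝ) 0ℓ → Pred (X → ℝ) 0ℓ
  Span A v = ∃[ k ] Σ[ c ∈ (Fin k → ℝ) ] Σ[ b ∈ (Fin k → X → ℝ) ]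
    (∀ j → b j ∈ A) × v ≋ linearCombination c b

  LinearlyIndependent : ∀ {d} → (Fin d → X → ℝ) → Set
  LinearlyIndependent b =
    ∀ c → linearCombination c b ≋ 𝟘 → ∀ j → c j ≈ᵣ 0ᵣ

  IsBasis : ∀ {d} → Pred (X → ℝ) 0ℓ → (Fin d → X → ℝ) → Set
  IsBasis V b =
    (∀ j → b j ∈ V) ×
    LinearlyIndependent b ×
    (∀ v → v ∈ V → ∃[ c ] v ≋ linearCombination c b)

  SubspaceHasDimension : Pred (X → ℝ) 0ℓ → ℕ → Set
  SubspaceHasDimension V d = Σ[ b ∈ (Fin d → X → ℝ) ] IsBasis V b

  IsCone : Pred (X → ℝ) 0ℓ → Set
  IsCone A = ∀ c v → 0ᵣ <ᵣ c → v ∈ A → c · v ∈ A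

  HasDimension : Pred (X → ℝ) 0ℓ → ℕ → Set
  HasDimension A d = SubspaceHasDimension (Span A) d

-- Vertex k of K_N is the element of Fin N whose toℕ is k - 1.
-- The proof of i < j is irrelevant, so a weight map depends only on i and j.
Edge : ℕ → Set
Edge N = [ (i , j) ∈ Fin N × Fin N ∣ i < j ]

WeightMap : ℕ → Set
WeightMap N = Edge N → ℝ≥0

cut : ∀ {N} → Subset N → Edge N → Bool
cut W e = let (i , j) = value e in lookup W i xor lookup W j

weightOver : ∀ {N} → (Edge N → Bool) → WeightMap N → Fin N → Fin N → ℝ
weightOver C w i j with i <? j
... | yes i<j = let e = ((i , j) ,ᵣ [ i<j ]) in if C e then proj₁ (w e) else 0ᵣ
... | no  _   = 0ᵣ

∥_∥ : ∀ {N} → (Edge N → Bool) → WeightMap N → ℝ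
∥ C ∥ w = sum λ i → sum λ j → weightOver C w i j

subsets : ∀ N → List (Subset N)
subsets zero    = [] ∷ []
subsets (suc N) = map (outside ∷_) (subsets N) ++ map (inside ∷_) (subsets N)

-- The minimum of f over { W ∣ P W }.  The given element of that set serves
-- only to start the fold; it is itself one of the filtered subsets, so the
-- result does not depend on it.
minimum : ∀ {N} {P : Pred (Subset N) 0ℓ} → Decidable P → ∃ P → (Subset N → ℝ) → ℝ
minimum {N} P? (W₀ , _) f = foldr _⊓ᵣ_ (f W₀) (map f (filter P? (subsets N)))

sink : ∀ {n N} → n ℕ.< N → Fin N
sink {N = suc M} _ = fromℕ M

-- W ⊆ [N-1] and W ∩ [n] = I; truncating W to its first n entries gives
-- W ∩ [n] as a subset of [n].
Separates : ∀ {n N} → n ℕ.< N → Subset n → Pred (Subset N) 0ℓ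
Separates n<N I W = sink n<N ∉ W × truncate (ℕ.<⇒≤ n<N) W ≡ I

separates? : ∀ {n N} (n<N : n ℕ.< N) I → Decidable (Separates n<N I)
separates? n<N I W =
  ¬? (sink n<N ∈? W) ×-dec ≡-dec Bool._≟_ (truncate (ℕ.<⇒≤ n<N) W) I

private
  sink-padRight : ∀ {n M} (n≤N : n ℕ.≤ suc M) → n ℕ.≤ M → (I : Subset n) →
                  lookup (padRight n≤N outside I) (fromℕ M) ≡ outside
  sink-padRight {M = M} z≤n z≤n [] = lookup-replicate (fromℕ M) outside
  sink-padRight (s≤s n≤N) (s≤s n≤M) (_ ∷ I) = sink-padRight n≤N n≤M I

separating : ∀ {n N} (n<N : n ℕ.< N) I → ∃ (Separates n<N I)
separating {N = suc M} n<N@(s≤s n≤M) I =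
  padRight (ℕ.<⇒≤ n<N) outside I , sink∉ , truncate-padRight (ℕ.<⇒≤ n<N) outside I
  where
  sink∉ : fromℕ M ∉ padRight (ℕ.<⇒≤ n<N) outside I
  sink∉ sink∈ with trans (sym ([]=⇒lookup sink∈)) (sink-padRight (ℕ.<⇒≤ n<N) n≤M I)
  ... | ()

minCut : ∀ {n N} → n ℕ.< N → WeightMap N → Subset n → ℝ
minCut n<N w I = minimum (separates? n<N I) (separating n<N I) (λ W → ∥ cut W ∥ w)

-- Nonemptiness is irrelevant: there are exactly 2 ^ n ∸ 1 indices.
NonemptySubset : ℕ → Set
NonemptySubset n = [ I ∈ Subset n ∣ Nonempty I ]

EntropyVector : ℕ → Set
EntropyVector n = NonemptySubset n → ℝ

ValidPair : ∀ {n N} → n ℕ.< N → EntropyVector n → WeightMap N → Set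
ValidPair n<N S w = ∀ I → S I ≈ᵣ minCut n<N w (value I)

HolographicEntropyCone : ∀ n → Pred (EntropyVector n) 0ℓ
HolographicEntropyCone n S =
  ∃[ N ] Σ[ n<N ∈ n ℕ.< N ] Σ[ w ∈ WeightMap N ] ValidPair n<N S w

-- Scaling the weights scales every cut, so H_n is a cone.
--
-- For full dimension, let J be a nonempty set of terminals and join a single
-- bulk vertex to every terminal in J with weight 1 and to the sink with weight
-- c.  The realized vector is S_I = min(|I ∩ J|, |J ∖ I| + c), which is |I ∩ J|
-- for c = |J| and |I ∩ J| - [J ⊆ I] for c = |J| - 1.  Hence the indicators of
-- {I ∣ J ⊆ I} lie in the span, and by Möbius inversion so do the standard basis
-- vectors.
module Submission where

open import Defs
open import Data.Nat using (ℕ; _≤_; _^_; _∸_)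
open import Data.Product using (_×_)

open import Algebra.Bundles using (CommutativeRing)
open import Data.Bool using (Bool; true; false; not; _xor_; if_then_else_)
open import Data.Bool.Properties using (if-eta)
open import Data.Fin using (Fin; zero; suc; fromℕ; _<_; _<?_; _≟_; splitAt; combine; remQuot; punchIn; punchOut)
open import Data.Fin.Properties
  using (2↔Bool; punchInᵢ≢i; combine-remQuot; remQuot-combine; punchIn-injective; punchIn-punchOut)
open import Data.Fin.Subset using (Subset; Nonempty; inside; outside; _⊆_; _∉_; ⊥) renaming (_∈_ to _∈ₛ_)
open import Data.Fin.Subset.Properties using (out⊆; s⊆s; ∉⊥; nonempty?; Empty-unique; drop-there)
open import Data.Irrelevant using ([_])
open import Data.List as List using (List; []; _∷_)
open import Data.List.Membership.Propositional using () renaming (_∈_ to _∈ˡ_)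
open import Data.List.Membership.Propositional.Properties using (∈-++⁺ˡ; ∈-++⁺ʳ; ∈-map⁺; ∈-filter⁺)
open import Data.List.Relation.Unary.All using (All; []; _∷_)
open import Data.List.Relation.Unary.All.Properties using (all-filter)
open import Data.List.Relation.Unary.Any using (here; there)
open import Data.Nat using (zero; suc; z≤n; s≤s)
import Data.Nat as ℕ
import Data.Nat.Properties as ℕ
open import Data.Product using (∃; ∃-syntax; Σ-syntax; _,_; proj₁; proj₂)
open import Data.Rational as ℚ using (ℚ; 0ℚ; 1ℚ; ∣_∣; _+_; _-_; _*_; -_; _⊓_)
import Data.Rational.Properties as ℚ
open import Data.Rational.Solver using (module +-*-Solver)
open import Data.Refinement using (value) renaming (_,_ to _,ᵣ_)
open import Data.Refinement.Properties using (value-injective)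
open import Data.Sum using (_⊎_; inj₁; inj₂)
open import Data.Sum.Properties using ([,]-map)
open import Data.Vec using ([]; _∷_; lookup; truncate; head; tail)
open import Data.Vec.Functional using (_++_; removeAt)
open import Data.Vec.Properties using ([]=⇒lookup; lookup⇒[]=)
open import Function using (_∘_; Inverse)
open import Level using (0ℓ)
open import Relation.Binary.PropositionalEquality
open import Relation.Nullary using (¬_; yes; no; does; contradiction)
open import Relation.Nullary.Decidable using (recompute; dec-true; dec-false)
open import Relation.Unary using (Pred; Decidable; _∈_)

open import Algebra.Properties.Semiring.Sum (CommutativeRing.semiring ℚ.+-*-commutativeRing)
  using (sum-cong-≗; sum-replicate-zero; sum-remove; *-distribˡ-sum)
  renaming (sum to sumℚ)

-- Finite sums over `ℚ`, and reals read term by term.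

sum-single : ∀ {k} (f : Fin k → ℚ) i → (∀ j → j ≢ i → f j ≡ 0ℚ) → sumℚ f ≡ f i
sum-single {suc k} f i zeros = begin
  sumℚ f                         ≡⟨ sum-remove {i = i} f ⟩
  f i + sumℚ (removeAt f i)      ≡⟨ cong (f i +_) (sum-cong-≗ λ j → zeros _ (punchInᵢ≢i i j)) ⟩
  f i + sumℚ {k} (λ _ → 0ℚ)      ≡⟨ cong (f i +_) (sum-replicate-zero k) ⟩
  f i + 0ℚ                       ≡⟨ ℚ.+-identityʳ (f i) ⟩
  f i                            ∎
  where open ≡-Reasoning

sum-++ : ∀ {k l} (f : Fin k → ℚ) (g : Fin l → ℚ) → sumℚ (f ++ g) ≡ sumℚ f + sumℚ g
sum-++ {zero}  f g = sym (ℚ.+-identityˡ (sumℚ g))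
sum-++ {suc k} f g = begin
  f zero + sumℚ ((f ++ g) ∘ suc)         ≡⟨ cong (f zero +_) (sum-cong-≗ λ i → [,]-map (splitAt k i)) ⟩
  f zero + sumℚ ((f ∘ suc) ++ g)         ≡⟨ cong (f zero +_) (sum-++ (f ∘ suc) g) ⟩
  f zero + (sumℚ (f ∘ suc) + sumℚ g)     ≡⟨ ℚ.+-assoc (f zero) (sumℚ (f ∘ suc)) (sumℚ g) ⟨
  f zero + sumℚ (f ∘ suc) + sumℚ g       ∎
  where open ≡-Reasoning

-- The operations on `ℝ` act termwise on representing sequences, so an identity between real
-- expressions can be checked as a rational identity at each index `m`. Together with `≗⇒≈` this is
-- how the equalities of reals below are obtained.
seq-sum : ∀ {k} (f : Fin k → ℝ) m → seq (sum f) m ≡ sumℚ (λ i → seq (f i) m)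
seq-sum {zero}  f m = refl
seq-sum {suc k} f m = cong (seq (f zero) m +_) (seq-sum (f ∘ suc) m)

≗⇒≈ : ∀ x y → (∀ m → seq x m ≡ seq y m) → x ≈ᵣ y
≗⇒≈ x y x≗y ε 0<ε = 0 , λ m _ →
  subst (ℚ._< ε) (sym (cong ∣_∣ (trans (cong (_- seq y m) (x≗y m)) (ℚ.+-inverseʳ (seq y m))))) 0<ε

bit : Bool → ℚ
bit b = if b then 1ℚ else 0ℚ

nonNegative-+ : ∀ p q → 0ℚ ℚ.≤ p → 0ℚ ℚ.≤ q → 0ℚ ℚ.≤ p + q
nonNegative-+ p q = ℚ.+-mono-≤ {0ℚ} {p} {0ℚ} {q}

nonNegative-* : ∀ p q → 0ℚ ℚ.≤ p → 0ℚ ℚ.≤ q → 0ℚ ℚ.≤ p * q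
nonNegative-* p q 0≤p 0≤q =
  ℚ.nonNegative⁻¹ (p * q) {{ℚ.nonNeg*nonNeg⇒nonNeg p {{ℚ.nonNegative 0≤p}} q {{ℚ.nonNegative 0≤q}}}}

p≤∣p∣ : ∀ p → p ℚ.≤ ∣ p ∣
p≤∣p∣ p with ℚ.≤-total 0ℚ p
... | inj₁ 0≤p = ℚ.≤-reflexive (sym (ℚ.0≤p⇒∣p∣≡p 0≤p))
... | inj₂ p≤0 = ℚ.≤-trans p≤0 (ℚ.0≤∣p∣ p)

-- Closure under positive scaling.

bounded-above : ∀ c → ∃[ B ] 0ℚ ℚ.< B × Eventually λ m → seq c m ℚ.< B
bounded-above c with cauchy c 1ℚ (ℚ.positive⁻¹ 1ℚ)
... | M , close = ∣ seq c M ∣ + 1ℚ , 0<B , M , λ m M≤m → begin-strict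
    seq c m                          ≡⟨ solve 2 (λ p q → p := q :+ (p :- q)) refl (seq c m) (seq c M) ⟩
    seq c M + (seq c m - seq c M)
      <⟨ ℚ.+-mono-≤-< {seq c M} {∣ seq c M ∣} {seq c m - seq c M} {1ℚ} (p≤∣p∣ (seq c M))
           (ℚ.≤-<-trans (p≤∣p∣ (seq c m - seq c M)) (close m M M≤m ℕ.≤-refl)) ⟩
    ∣ seq c M ∣ + 1ℚ                 ∎
  where
  open ℚ.≤-Reasoning
  open +-*-Solver
  0<B : 0ℚ ℚ.< ∣ seq c M ∣ + 1ℚ
  0<B = ℚ.+-mono-≤-< {0ℚ} {∣ seq c M ∣} {0ℚ} {1ℚ} (ℚ.0≤∣p∣ (seq c M)) (ℚ.positive⁻¹ 1ℚ)

divide : ∀ B ε → 0ℚ ℚ.< B → 0ℚ ℚ.< ε → ∃[ δ ] 0ℚ ℚ.< δ × B * δ ≡ ε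
divide B ε 0<B 0<ε = δ , 0<δ , B*δ≡ε
  where
  instance
    B-pos : ℚ.Positive B
    B-pos = ℚ.positive 0<B
    B-nonZero : ℚ.NonZero B
    B-nonZero = ℚ.pos⇒nonZero B
    1/B-pos : ℚ.Positive (ℚ.1/ B)
    1/B-pos = ℚ.1/pos⇒pos B
  δ = ℚ.1/ B * ε
  0<δ : 0ℚ ℚ.< δ
  0<δ = subst (ℚ._< δ) (ℚ.*-zeroʳ (ℚ.1/ B)) (ℚ.*-monoʳ-<-pos (ℚ.1/ B) 0<ε)
  B*δ≡ε : B * δ ≡ ε
  B*δ≡ε = trans (sym (ℚ.*-assoc B (ℚ.1/ B) ε))
         (trans (cong (_* ε) (ℚ.*-inverseʳ B)) (ℚ.*-identityˡ ε))

eventually-nonNegative : ∀ c → 0ᵣ <ᵣ c → Eventually λ m → 0ℚ ℚ.≤ seq c m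
eventually-nonNegative c (η , 0<η , L , η≤c) = L , λ m L≤m →
  ℚ.≤-trans (ℚ.<⇒≤ 0<η) (subst (ℚ._≤ seq c m) (ℚ.+-identityˡ η) (η≤c m L≤m))

-- Supplies the tolerance for multiplication by `c`: with `B` an eventual upper bound of `c`, take
-- `δ = ε / B`. Since `c` is eventually nonnegative, a one-sided bound is enough.
small-multiple : ∀ c → 0ᵣ <ᵣ c → ∀ ε → 0ℚ ℚ.< ε →
  ∃[ δ ] 0ℚ ℚ.< δ × Eventually λ m → 0ℚ ℚ.≤ seq c m × seq c m * δ ℚ.< ε
small-multiple c 0<c ε 0<ε =
  let (L , 0≤c) = eventually-nonNegative c 0<c
      (B , 0<B , M , c<B) = bounded-above c
      (δ , 0<δ , B*δ≡ε) = divide B ε 0<B 0<ε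
  in δ , 0<δ , L ℕ.⊔ M , λ m ≤m →
     0≤c m (ℕ.m⊔n≤o⇒m≤o L M ≤m) ,
     subst (seq c m * δ ℚ.<_) B*δ≡ε
       (ℚ.*-monoˡ-<-pos δ {{ℚ.positive 0<δ}} {seq c m} {B} (c<B m (ℕ.m⊔n≤o⇒n≤o L M ≤m)))

*-factorˡ-difference : ∀ c p q → c * p - c * q ≡ c * (p - q)
*-factorˡ-difference = solve 3 (λ c p q → c :* p :- c :* q := c :* (p :- q)) refl
  where open +-*-Solver

*ᵣ-congˡ : ∀ c → 0ᵣ <ᵣ c → ∀ x y → x ≈ᵣ y → c *ᵣ x ≈ᵣ c *ᵣ y
*ᵣ-congˡ c 0<c x y x≈y ε 0<ε =
  let (δ , 0<δ , L , small) = small-multiple c 0<c ε 0<ε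
      (M , close) = x≈y δ 0<δ
  in L ℕ.⊔ M , λ m ≤m →
     bound (seq c m) (seq x m) (seq y m) δ (small m (ℕ.m⊔n≤o⇒m≤o L M ≤m)) (close m (ℕ.m⊔n≤o⇒n≤o L M ≤m))
  where
  open ℚ.≤-Reasoning
  bound : ∀ c x y δ → 0ℚ ℚ.≤ c × c * δ ℚ.< ε → ∣ x - y ∣ ℚ.< δ → ∣ c * x - c * y ∣ ℚ.< ε
  bound c x y δ (0≤c , cδ<ε) close = begin-strict
    ∣ c * x - c * y ∣    ≡⟨ cong ∣_∣ (*-factorˡ-difference c x y) ⟩
    ∣ c * (x - y) ∣      ≡⟨ ℚ.∣p*q∣≡∣p∣*∣q∣ c (x - y) ⟩
    ∣ c ∣ * ∣ x - y ∣    ≡⟨ cong (_* ∣ x - y ∣) (ℚ.0≤p⇒∣p∣≡p 0≤c) ⟩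
    c * ∣ x - y ∣        ≤⟨ ℚ.*-monoˡ-≤-nonNeg c {{ℚ.nonNegative 0≤c}} (ℚ.<⇒≤ close) ⟩
    c * δ                <⟨ cδ<ε ⟩
    ε                    ∎

-- The terms of a nonnegative real may be slightly negative, so the shifted term `x + δ` is
-- multiplied instead, and the extra `c * δ` is absorbed by `ε`.
*ᵣ-nonNegative : ∀ c → 0ᵣ <ᵣ c → ∀ x → 0ᵣ ≤ᵣ x → 0ᵣ ≤ᵣ c *ᵣ x
*ᵣ-nonNegative c 0<c x 0≤x ε 0<ε =
  let (δ , 0<δ , L , small) = small-multiple c 0<c ε 0<ε
      (M , 0≤x+δ) = 0≤x δ 0<δ
  in L ℕ.⊔ M , λ m ≤m →
     bound (seq c m) (seq x m) δ (small m (ℕ.m⊔n≤o⇒m≤o L M ≤m)) (0≤x+δ m (ℕ.m⊔n≤o⇒n≤o L M ≤m))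
  where
  open ℚ.≤-Reasoning
  bound : ∀ c x δ → 0ℚ ℚ.≤ c × c * δ ℚ.< ε → 0ℚ ℚ.≤ x + δ → 0ℚ ℚ.≤ c * x + ε
  bound c x δ (0≤c , cδ<ε) 0≤x+δ = begin
    0ℚ               ≤⟨ nonNegative-* c (x + δ) 0≤c 0≤x+δ ⟩
    c * (x + δ)      ≡⟨ ℚ.*-distribˡ-+ c x δ ⟩
    c * x + c * δ    ≤⟨ ℚ.+-monoʳ-≤ (c * x) {c * δ} {ε} (ℚ.<⇒≤ cδ<ε) ⟩
    c * x + ε        ∎

-- Agreement is asked only from some index on, because the early terms of a positive real may be
-- negative, and there multiplication does not distribute over `⊓`.
≈-respʳ-≗ : ∀ x y z → Eventually (λ m → seq y m ≡ seq z m) → x ≈ᵣ y → x ≈ᵣ z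
≈-respʳ-≗ x y z (L , y≗z) x≈y ε 0<ε =
  let (M , close) = x≈y ε 0<ε
  in L ℕ.⊔ M , λ m ≤m →
     subst (λ p → ∣ seq x m - p ∣ ℚ.< ε) (y≗z m (ℕ.m⊔n≤o⇒m≤o L M ≤m)) (close m (ℕ.m⊔n≤o⇒n≤o L M ≤m))

-- Both minima fold over the same filtered list from the same starting set, so a nonnegative factor
-- moves through the fold one `⊓` at a time.
seq-*ᵣ-minimum : ∀ {N} {P : Pred (Subset N) 0ℓ} (P? : Decidable P) W₀ c (f g : Subset N → ℝ) m →
  0ℚ ℚ.≤ seq c m → (∀ W → seq c m * seq (f W) m ≡ seq (g W) m) →
  seq c m * seq (minimum P? W₀ f) m ≡ seq (minimum P? W₀ g) m
seq-*ᵣ-minimum {N} P? (W₀ , _) c f g m 0≤c f≗g = go (List.filter P? (subsets N))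
  where
  go : ∀ Ws → seq c m * seq (List.foldr _⊓ᵣ_ (f W₀) (List.map f Ws)) m ≡
              seq (List.foldr _⊓ᵣ_ (g W₀) (List.map g Ws)) m
  go []       = f≗g W₀
  go (W ∷ Ws) =
    trans (ℚ.*-distribˡ-⊓-nonNeg (seq c m) {{ℚ.nonNegative 0≤c}} (seq (f W) m) _) (cong₂ _⊓_ (f≗g W) (go Ws))

scale : ∀ c → 0ᵣ <ᵣ c → ∀ {N} → WeightMap N → WeightMap N
scale c 0<c w e = c *ᵣ proj₁ (w e) , *ᵣ-nonNegative c 0<c (proj₁ (w e)) (proj₂ (w e))

seq-*ᵣ-sum : ∀ {k} c (f g : Fin k → ℝ) m → (∀ i → seq c m * seq (f i) m ≡ seq (g i) m) →
  seq c m * seq (sum f) m ≡ seq (sum g) m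
seq-*ᵣ-sum c f g m f≗g = begin
  seq c m * seq (sum f) m                   ≡⟨ cong (seq c m *_) (seq-sum f m) ⟩
  seq c m * sumℚ (λ i → seq (f i) m)        ≡⟨ *-distribˡ-sum (seq c m) (λ i → seq (f i) m) ⟩
  sumℚ (λ i → seq c m * seq (f i) m)        ≡⟨ sum-cong-≗ f≗g ⟩
  sumℚ (λ i → seq (g i) m)                  ≡⟨ seq-sum g m ⟨
  seq (sum g) m                             ∎
  where open ≡-Reasoning

-- Both sides branch on the same tests, so one case split resolves them together. The relation is
-- abstract so that the split can be made apart from the arithmetic.
weightOver-relate : ∀ {N} (_∼_ : ℝ → ℝ → Set) (C : Edge N → Bool) (w w′ : WeightMap N) i j →
  0ᵣ ∼ 0ᵣ → (∀ e → proj₁ (w e) ∼ proj₁ (w′ e)) → weightOver C w i j ∼ weightOver C w′ i j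
weightOver-relate _∼_ C w w′ i j zeros weights with i <? j
... | no  _   = zeros
... | yes i<j with C ((i , j) ,ᵣ [ i<j ])
... | true  = weights ((i , j) ,ᵣ [ i<j ])
... | false = zeros

seq-*ᵣ-∥∥ : ∀ c (0<c : 0ᵣ <ᵣ c) {N} (C : Edge N → Bool) (w : WeightMap N) m →
  seq c m * seq (∥ C ∥ w) m ≡ seq (∥ C ∥ (scale c 0<c w)) m
seq-*ᵣ-∥∥ c 0<c C w m =
  seq-*ᵣ-sum c (λ i → sum λ j → weightOver C w i j) (λ i → sum λ j → weightOver C cw i j) m λ i →
  seq-*ᵣ-sum c (weightOver C w i) (weightOver C cw i) m λ j →
  weightOver-relate (λ x y → seq c m * seq x m ≡ seq y m) C w cw i j (ℚ.*-zeroʳ (seq c m)) (λ _ → refl)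
  where cw = scale c 0<c w

holographicEntropyCone-isCone : ∀ n → IsCone (HolographicEntropyCone n)
holographicEntropyCone-isCone n c S 0<c (N , n<N , w , valid) =
  N , n<N , scale c 0<c w , λ I →
    ≈-respʳ-≗ (c *ᵣ S I) (c *ᵣ minCut n<N w (value I)) (minCut n<N (scale c 0<c w) (value I))
      (let (L , 0≤c) = eventually-nonNegative c 0<c
       in L , λ m L≤m → seq-*ᵣ-minimum (separates? n<N (value I)) (separating n<N (value I)) c
            (λ W → ∥ cut W ∥ w) (λ W → ∥ cut W ∥ (scale c 0<c w)) m (0≤c m L≤m)
            (λ W → seq-*ᵣ-∥∥ c 0<c (cut W) w m))
      (*ᵣ-congˡ c 0<c (S I) (minCut n<N w (value I)) (valid I))

-- Cut weights and linear spans over `ℚ`.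

crossWeights : ∀ {N} → (Fin N → Fin N → ℚ) → Subset N → ℚ
crossWeights g W = sumℚ λ i → sumℚ λ j → if lookup W i xor lookup W j then g i j else 0ℚ

-- All vectors used to build the basis have rational entries, so they are combined over `ℚ` with
-- exact equality and carried into the real `Span` only at the end.
RationalSpan : ∀ {X : Set} → Pred (X → ℝ) 0ℓ → Pred (X → ℚ) 0ℓ
RationalSpan {X} A f = ∃[ k ] Σ[ c ∈ (Fin k → ℚ) ] Σ[ g ∈ (Fin k → X → ℚ) ]
  (∀ j → (fromℚ ∘ g j) ∈ A) × (∀ x → f x ≡ sumℚ λ j → c j * g j x)

RationalSpan⇒Span : ∀ {X : Set} {A : Pred (X → ℝ) 0ℓ} {f} → f ∈ RationalSpan A → (fromℚ ∘ f) ∈ Span A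
RationalSpan⇒Span {f = f} (k , c , g , g∈A , f≗) =
  k , fromℚ ∘ c , (λ j → fromℚ ∘ g j) , g∈A , λ x → ≗⇒≈ (fromℚ (f x)) (linearCombination (fromℚ ∘ c) (λ j → fromℚ ∘ g j) x) λ m →
    trans (f≗ x) (sym (seq-sum (λ j → fromℚ (c j) *ᵣ fromℚ (g j x)) m))

-- The two families are concatenated, with the second list of coefficients negated. This is the
-- closure property that `möbius` consumes.
RationalSpan-difference : ∀ {X : Set} {A : Pred (X → ℝ) 0ℓ} {f g h} →
  f ∈ RationalSpan A → g ∈ RationalSpan A → (∀ x → h x ≡ f x - g x) → h ∈ RationalSpan A
RationalSpan-difference {X} {A} {f} {g} {h} (k , c , u , u∈A , f≗) (l , d , v , v∈A , g≗) h≗ =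
  k ℕ.+ l , (c ++ (-_ ∘ d)) , (u ++ v) , members , λ x → begin
    h x                                                              ≡⟨ h≗ x ⟩
    f x - g x                                                        ≡⟨ cong₂ _-_ (f≗ x) (g≗ x) ⟩
    sumℚ (λ j → c j * u j x) - sumℚ (λ j → d j * v j x)              ≡⟨ cong (sumℚ (λ j → c j * u j x) +_) (negate x) ⟩
    sumℚ (λ j → c j * u j x) + sumℚ (λ j → - d j * v j x)
      ≡⟨ sum-++ (λ j → c j * u j x) (λ j → - d j * v j x) ⟨
    sumℚ ((λ j → c j * u j x) ++ (λ j → - d j * v j x))              ≡⟨ sum-cong-≗ (products x) ⟨
    sumℚ (λ j → (c ++ (-_ ∘ d)) j * (u ++ v) j x)                    ∎
  where
  open ≡-Reasoning
  members : ∀ j → (fromℚ ∘ (u ++ v) j) ∈ A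
  members j with splitAt k j
  ... | inj₁ i = u∈A i
  ... | inj₂ i = v∈A i
  products : ∀ x j → (c ++ (-_ ∘ d)) j * (u ++ v) j x ≡
                     ((λ j → c j * u j x) ++ (λ j → - d j * v j x)) j
  products x j with splitAt k j
  ... | inj₁ i = refl
  ... | inj₂ i = refl
  neg≡ : ∀ p → - p ≡ - 1ℚ * p
  neg≡ = solve 1 (λ p → :- p := (:- con 1ℚ) :* p) refl
    where open +-*-Solver
  negate : ∀ x → - sumℚ (λ j → d j * v j x) ≡ sumℚ (λ j → - d j * v j x)
  negate x = begin
    - sumℚ (λ j → d j * v j x)        ≡⟨ neg≡ (sumℚ λ j → d j * v j x) ⟩
    - 1ℚ * sumℚ (λ j → d j * v j x)   ≡⟨ *-distribˡ-sum (- 1ℚ) (λ j → d j * v j x) ⟩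
    sumℚ (λ j → - 1ℚ * (d j * v j x)) ≡⟨ sum-cong-≗ (λ j → solve 2 (λ p q → (:- con 1ℚ) :* (p :* q) := (:- p) :* q) refl (d j) (v j x)) ⟩
    sumℚ (λ j → - d j * v j x)        ∎
    where open +-*-Solver

-- Indicators of up-sets and of single sets.

containing : ∀ {n} → Subset n → Subset n → ℚ
containing []            _ = 1ℚ
containing (inside ∷ J)  I = bit (head I) * containing J (tail I)
containing (outside ∷ J) I = containing J (tail I)

-- Like `containing`, a product with one factor per terminal. Reading `I` through `head` and `tail`
-- makes both unfold by recursion on the first set alone, so that `möbius` can move the factors
-- already treated into its predicate `V`.
equalling : ∀ {n} → Subset n → Subset n → ℚ
equalling []            _ = 1ℚ
equalling (inside ∷ K)  I = bit (head I) * equalling K (tail I)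
equalling (outside ∷ K) I = bit (not (head I)) * equalling K (tail I)

-- Each terminal outside K contributes a factor 1 - x to the indicator of K, so
-- one subtraction per such terminal turns indicators of up-sets into it.
möbius : ∀ {n} (V : Pred (Subset n → ℚ) 0ℓ) →
  (∀ {f g h} → f ∈ V → g ∈ V → (∀ I → h I ≡ f I - g I) → h ∈ V) →
  ∀ K → (∀ J → K ⊆ J → containing J ∈ V) → equalling K ∈ V
möbius V difference [] up = up [] (λ ())
möbius V difference (inside ∷ K) up =
  möbius (λ f → V λ I → bit (head I) * f (tail I))
    (λ {f} {g} {h} f∈V g∈V h≗ → difference f∈V g∈V λ I →
      trans (cong (bit (head I) *_) (h≗ (tail I)))
        (solve 3 (λ b p q → b :* (p :- q) := b :* p :- b :* q) refl (bit (head I)) (f (tail I)) (g (tail I))))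
    K (λ J K⊆J → up (inside ∷ J) (s⊆s K⊆J))
  where open +-*-Solver
möbius V difference (outside ∷ K) up =
  möbius (λ f → V λ I → bit (not (head I)) * f (tail I))
    (λ {f} {g} {h} f∈V g∈V h≗ → difference f∈V g∈V λ I →
      trans (cong (bit (not (head I)) *_) (h≗ (tail I)))
        (solve 3 (λ b p q → b :* (p :- q) := b :* p :- b :* q) refl (bit (not (head I))) (f (tail I)) (g (tail I))))
    K (λ J K⊆J → difference (up (outside ∷ J) (out⊆ K⊆J)) (up (inside ∷ J) (out⊆ K⊆J)) λ I → complement (head I) (containing J (tail I)))
  where
  open +-*-Solver
  complement : ∀ b p → bit (not b) * p ≡ p - bit b * p
  complement true  = solve 1 (λ p → con 0ℚ :* p := p :- con 1ℚ :* p) refl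
  complement false = solve 1 (λ p → con 1ℚ :* p := p :- con 0ℚ :* p) refl

equalling-refl : ∀ {n} (K : Subset n) → equalling K K ≡ 1ℚ
equalling-refl []            = refl
equalling-refl (inside ∷ K)  = trans (ℚ.*-identityˡ (equalling K K)) (equalling-refl K)
equalling-refl (outside ∷ K) = trans (ℚ.*-identityˡ (equalling K K)) (equalling-refl K)

equalling-≢ : ∀ {n} (K I : Subset n) → K ≢ I → equalling K I ≡ 0ℚ
equalling-≢ []            []            K≢I = contradiction refl K≢I
equalling-≢ (inside ∷ K)  (inside ∷ I)  K≢I =
  trans (ℚ.*-identityˡ (equalling K I)) (equalling-≢ K I (K≢I ∘ cong (inside ∷_)))
equalling-≢ (inside ∷ K)  (outside ∷ I) K≢I = ℚ.*-zeroˡ (equalling K I)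
equalling-≢ (outside ∷ K) (inside ∷ I)  K≢I = ℚ.*-zeroˡ (equalling K I)
equalling-≢ (outside ∷ K) (outside ∷ I) K≢I =
  trans (ℚ.*-identityˡ (equalling K I)) (equalling-≢ K I (K≢I ∘ cong (outside ∷_)))

-- The star graphs and their weights.

-- The hub is the only bulk vertex: it is joined to each terminal in J with
-- weight 1 and to the sink with weight c.
hub : ∀ n → Fin (2 ℕ.+ n)
hub zero    = zero
hub (suc n) = suc (hub n)

spoke : ∀ {n} → Bool → Fin (3 ℕ.+ n) → ℚ
spoke {n} b j = if does (j ≟ hub (suc n)) then bit b else 0ℚ

star : ∀ {n} → Subset n → ℚ → Fin (2 ℕ.+ n) → Fin (2 ℕ.+ n) → ℚ
star []      c zero    zero       = 0ℚ
star []      c zero    (suc zero) = c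
star []      c (suc _) _          = 0ℚ
star (b ∷ J) c zero    j          = spoke b j
star (b ∷ J) c (suc i) zero       = 0ℚ
star (b ∷ J) c (suc i) (suc j)    = star J c i j

bit-nonNegative : ∀ b → 0ℚ ℚ.≤ bit b
bit-nonNegative true  = ℚ.<⇒≤ (ℚ.positive⁻¹ 1ℚ)
bit-nonNegative false = ℚ.≤-refl

if-nonNegative : ∀ b {p} → 0ℚ ℚ.≤ p → 0ℚ ℚ.≤ (if b then p else 0ℚ)
if-nonNegative true  0≤p = 0≤p
if-nonNegative false _   = ℚ.≤-refl

star-nonNegative : ∀ {n} (J : Subset n) {c} → 0ℚ ℚ.≤ c → ∀ i j → 0ℚ ℚ.≤ star J c i j
star-nonNegative []      0≤c zero    zero       = ℚ.≤-refl
star-nonNegative []      0≤c zero    (suc zero) = 0≤c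
star-nonNegative []      0≤c (suc _) _          = ℚ.≤-refl
star-nonNegative {suc n} (b ∷ J) 0≤c zero    j  = if-nonNegative (does (j ≟ hub (suc n))) (bit-nonNegative b)
star-nonNegative (b ∷ J) 0≤c (suc i) zero       = ℚ.≤-refl
star-nonNegative (b ∷ J) 0≤c (suc i) (suc j)    = star-nonNegative J 0≤c i j

-- Terminals are numbered before the hub and the hub before the sink, so every weight sits above the
-- diagonal. Hence `crossWeights` may run over all ordered pairs and still give the weight of the
-- cut.
star-≮ : ∀ {n} (J : Subset n) c i j → ¬ (i < j) → star J c i j ≡ 0ℚ
star-≮ []      c zero    zero       i≮j = refl
star-≮ []      c zero    (suc zero) i≮j = contradiction (s≤s z≤n) i≮j
star-≮ []      c (suc _) _          i≮j = refl
star-≮ (b ∷ J) c zero    zero       i≮j = refl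
star-≮ (b ∷ J) c zero    (suc j)    i≮j = contradiction (s≤s z≤n) i≮j
star-≮ (b ∷ J) c (suc i) zero       i≮j = refl
star-≮ (b ∷ J) c (suc i) (suc j)    i≮j = star-≮ J c i j (i≮j ∘ s≤s)

starWeight : ∀ {n} → Subset n → ∀ c → 0ℚ ℚ.≤ c → WeightMap (2 ℕ.+ n)
starWeight J c 0≤c e = let (i , j) = value e in
  fromℚ (star J c i j) , λ ε 0<ε → 0 , λ _ _ → nonNegative-+ (star J c i j) ε (star-nonNegative J 0≤c i j) (ℚ.<⇒≤ 0<ε)

weightOver-star : ∀ {n} (J : Subset n) c 0≤c W i j →
  weightOver (cut W) (starWeight J c 0≤c) i j ≡ fromℚ (if lookup W i xor lookup W j then star J c i j else 0ℚ)
weightOver-star J c 0≤c W i j with i <? j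
... | no  i≮j = cong fromℚ (sym (trans (cong (if lookup W i xor lookup W j then_else 0ℚ) (star-≮ J c i j i≮j)) (if-eta (lookup W i xor lookup W j))))
... | yes _   with lookup W i xor lookup W j
... | true  = refl
... | false = refl

seq-∥∥ : ∀ {N} (C : Edge N → Bool) (w : WeightMap N) m (g : Fin N → Fin N → ℚ) →
  (∀ i j → seq (weightOver C w i j) m ≡ g i j) → seq (∥ C ∥ w) m ≡ sumℚ λ i → sumℚ (g i)
seq-∥∥ C w m g w≗g = begin
  seq (∥ C ∥ w) m                                     ≡⟨ seq-sum (λ i → sum (weightOver C w i)) m ⟩
  sumℚ (λ i → seq (sum (weightOver C w i)) m)         ≡⟨ sum-cong-≗ (λ i → seq-sum (weightOver C w i) m) ⟩
  sumℚ (λ i → sumℚ λ j → seq (weightOver C w i j) m)  ≡⟨ sum-cong-≗ (λ i → sum-cong-≗ (w≗g i)) ⟩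
  sumℚ (λ i → sumℚ (g i))                             ∎
  where open ≡-Reasoning

seq-∥cut∥-star : ∀ {n} (J : Subset n) c 0≤c W m →
  seq (∥ cut W ∥ (starWeight J c 0≤c)) m ≡ crossWeights (star J c) W
seq-∥cut∥-star J c 0≤c W m =
  seq-∥∥ (cut W) (starWeight J c 0≤c) m (λ i j → if lookup W i xor lookup W j then star J c i j else 0ℚ)
    λ i j → cong (λ x → seq x m) (weightOver-star J c 0≤c W i j)

-- Cuts of the star.

extend : ∀ {n} → Subset n → Bool → Subset (2 ℕ.+ n)
extend []      y = y ∷ outside ∷ []
extend (x ∷ I) y = x ∷ extend I y

lookup-extend-hub : ∀ {n} (I : Subset n) y → lookup (extend I y) (hub n) ≡ y
lookup-extend-hub []      y = refl
lookup-extend-hub (x ∷ I) y = lookup-extend-hub I y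

lookup-extend-sink : ∀ {n} (I : Subset n) y → lookup (extend I y) (fromℕ (suc n)) ≡ outside
lookup-extend-sink []      y = refl
lookup-extend-sink (x ∷ I) y = lookup-extend-sink I y

truncate-extend : ∀ {n} (n≤N : n ≤ 2 ℕ.+ n) (I : Subset n) y → truncate n≤N (extend I y) ≡ I
truncate-extend z≤n       []      y = refl
truncate-extend (s≤s n≤N) (x ∷ I) y = cong (x ∷_) (truncate-extend n≤N I y)

extend-truncate : ∀ {n} (n≤N : n ≤ 2 ℕ.+ n) (W : Subset (2 ℕ.+ n)) → lookup W (fromℕ (suc n)) ≡ outside →
  ∃[ y ] W ≡ extend (truncate n≤N W) y
extend-truncate z≤n       (y ∷ z ∷ []) refl = y , refl
extend-truncate (s≤s n≤N) (x ∷ W)      last =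
  let (y , eq) = extend-truncate n≤N W last in y , cong (x ∷_) eq

separates-extend : ∀ {n} (n<N : n ℕ.< 2 ℕ.+ n) (I : Subset n) y → Separates n<N I (extend I y)
separates-extend n<N I y = sink∉ , truncate-extend (ℕ.<⇒≤ n<N) I y
  where
  sink∉ : sink n<N ∉ extend I y
  sink∉ sink∈ with trans (sym ([]=⇒lookup sink∈)) (lookup-extend-sink I y)
  ... | ()

-- The terminals and the sink are prescribed, so only the side of the hub is free: the minimum
-- defining `S_I` ranges over just two sets.
separates⇒extend : ∀ {n} (n<N : n ℕ.< 2 ℕ.+ n) (I : Subset n) W → Separates n<N I W → ∃[ y ] W ≡ extend I y
separates⇒extend {n} n<N I W (sink∉ , refl) = extend-truncate (ℕ.<⇒≤ n<N) W last
  where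
  last : lookup W (fromℕ (suc n)) ≡ outside
  last with lookup W (fromℕ (suc n)) in eq
  ... | outside = refl
  ... | inside  = contradiction (lookup⇒[]= (fromℕ (suc n)) W eq) sink∉

-- |I ∩ J| if y is outside (hub on the sink's side of the cut), and |J ∖ I| if
-- y is inside; the hub-sink edge is not counted.
crossing : ∀ {n} → Bool → Subset n → Subset n → ℚ
crossing y []      _ = 0ℚ
crossing y (b ∷ J) I = (if head I xor y then bit b else 0ℚ) + crossing y J (tail I)

if-zero : ∀ b {p} → p ≡ 0ℚ → (if b then p else 0ℚ) ≡ 0ℚ
if-zero b refl = if-eta b

sum-spoke : ∀ {n} x b (I : Subset (suc n)) y →
  sumℚ (λ j → if x xor lookup (extend I y) j then spoke b j else 0ℚ) ≡ (if x xor y then bit b else 0ℚ)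
sum-spoke {n} x b I y = trans
  (sum-single f (hub (suc n)) λ j j≢hub → if-zero (x xor lookup (extend I y) j)
    (cong (if_then bit b else 0ℚ) (dec-false (j ≟ hub (suc n)) j≢hub)))
  (cong₂ (if_then_else 0ℚ) (cong (x xor_) (lookup-extend-hub I y))
    (cong (if_then bit b else 0ℚ) (dec-true (hub (suc n) ≟ hub (suc n)) refl)))
  where
  f : Fin (3 ℕ.+ n) → ℚ
  f j = if x xor lookup (extend I y) j then spoke b j else 0ℚ

-- Splits off the first vertex, matching the recursion of `star` and `extend`. Its column vanishes,
-- so its edges are all counted in its row.
crossWeights-suc : ∀ {N} (g : Fin (suc N) → Fin (suc N) → ℚ) x (W : Subset N) → (∀ i → g (suc i) zero ≡ 0ℚ) →
  crossWeights g (x ∷ W) ≡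
  sumℚ (λ j → if x xor lookup (x ∷ W) j then g zero j else 0ℚ) + crossWeights (λ i j → g (suc i) (suc j)) W
crossWeights-suc {N} g x W column = cong (sumℚ (row zero) +_) (sum-cong-≗ λ i →
  trans (cong (_+ sumℚ (row (suc i) ∘ suc)) (if-zero (lookup W i xor x) (column i)))
        (ℚ.+-identityˡ (sumℚ (row (suc i) ∘ suc))))
  where
  row : Fin (suc N) → Fin (suc N) → ℚ
  row i j = if lookup (x ∷ W) i xor lookup (x ∷ W) j then g i j else 0ℚ

-- Each terminal contributes only its spoke. Once the terminals are peeled off, the hub-sink edge
-- remains, and it is cut exactly when the hub is in the set.
crossWeights-star : ∀ {n} (J : Subset n) c I y →
  crossWeights (star J c) (extend I y) ≡ crossing y J I + (if y then c else 0ℚ)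
crossWeights-star [] c [] true  =
  solve 1 (λ c → (con 0ℚ :+ (c :+ con 0ℚ)) :+ ((con 0ℚ :+ (con 0ℚ :+ con 0ℚ)) :+ con 0ℚ) := con 0ℚ :+ c) refl c
  where open +-*-Solver
crossWeights-star [] c [] false = refl
crossWeights-star (b ∷ J) c (x ∷ I) y =
  trans (crossWeights-suc (star (b ∷ J) c) x (extend I y) (λ _ → refl))
 (trans (cong₂ _+_ (sum-spoke x b (x ∷ I) y) (crossWeights-star J c I y))
        (sym (ℚ.+-assoc (if x xor y then bit b else 0ℚ) (crossing y J I) (if y then c else 0ℚ))))

-- Minimum cuts of the star.

∈-subsets : ∀ {N} (W : Subset N) → W ∈ˡ subsets N
∈-subsets         []            = here refl
∈-subsets {suc N} (outside ∷ W) = ∈-++⁺ˡ (∈-map⁺ (outside ∷_) (∈-subsets W))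
∈-subsets {suc N} (inside ∷ W)  = ∈-++⁺ʳ (List.map (outside ∷_) (subsets N)) (∈-map⁺ (inside ∷_) (∈-subsets W))

seq-minimum : ∀ {N} {P : Pred (Subset N) 0ℓ} (P? : Decidable P) W₀ (f : Subset N → ℝ) m v →
  (∀ W → W ∈ P → v ℚ.≤ seq (f W) m) → (∃[ W ] W ∈ P × seq (f W) m ≡ v) → seq (minimum P? W₀ f) m ≡ v
seq-minimum {N} {P} P? (W₀ , W₀∈P) f m v lower (W , W∈P , fW≡v) =
  ℚ.≤-antisym
    (subst (least Ws ℚ.≤_) fW≡v (least≤ Ws (∈-filter⁺ P? (∈-subsets W) W∈P)))
    (≤least Ws (all-filter P? (subsets N)))
  where
  Ws = List.filter P? (subsets N)
  least : List (Subset N) → ℚ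
  least Ws = seq (List.foldr _⊓ᵣ_ (f W₀) (List.map f Ws)) m
  ≤least : ∀ Ws → All P Ws → v ℚ.≤ least Ws
  -- The fold starts from the value at a member of `P`, so the lower bound covers the starting value
  -- as well.
  ≤least []       []           = lower W₀ W₀∈P
  ≤least (U ∷ Ws) (U∈P ∷ Ws∈P) = ℚ.⊓-glb (lower U U∈P) (≤least Ws Ws∈P)
  least≤ : ∀ {U} Ws → U ∈ˡ Ws → least Ws ℚ.≤ seq (f U) m
  least≤ (U ∷ Ws) (here refl) = ℚ.p⊓q≤p (seq (f U) m) (least Ws)
  least≤ (U ∷ Ws) (there U∈)  = ℚ.≤-trans (ℚ.p⊓q≤q (seq (f U) m) (least Ws)) (least≤ Ws U∈)

seq-minCut : ∀ {n N} (n<N : n ℕ.< N) (w : WeightMap N) I m (weight : Subset N → ℚ) v →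
  (∀ W → seq (∥ cut W ∥ w) m ≡ weight W) →
  (∀ W → W ∈ Separates n<N I → v ℚ.≤ weight W) → (∃[ W ] W ∈ Separates n<N I × weight W ≡ v) →
  seq (minCut n<N w I) m ≡ v
seq-minCut n<N w I m weight v weight≗ lower (W , W∈ , attained) =
  seq-minimum (separates? n<N I) (separating n<N I) (λ W → ∥ cut W ∥ w) m v
    (λ W W∈ → subst (v ℚ.≤_) (sym (weight≗ W)) (lower W W∈))
    (W , W∈ , trans (weight≗ W) attained)

-- The two terms are the cuts with the hub on the sink's side and on the side of `I`. The `+ 0ℚ` is
-- kept so that they are definitionally the two cases of the formula in `crossWeights-star`.
starCut : ∀ {n} → Subset n → ℚ → Subset n → ℚ
starCut J c I = (crossing outside J I + 0ℚ) ⊓ (crossing inside J I + c)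

seq-minCut-star : ∀ {n} (n<N : n ℕ.< 2 ℕ.+ n) (J : Subset n) c 0≤c I m →
  seq (minCut n<N (starWeight J c 0≤c) I) m ≡ starCut J c I
seq-minCut-star n<N J c 0≤c I m =
  seq-minCut n<N (starWeight J c 0≤c) I m (crossWeights (star J c)) (starCut J c I)
    (λ W → seq-∥cut∥-star J c 0≤c W m) lower (attained (ℚ.⊓-sel (side false) (side true)))
  where
  side : Bool → ℚ
  side y = crossing y J I + (if y then c else 0ℚ)
  starCut≤side : ∀ y → starCut J c I ℚ.≤ side y
  starCut≤side false = ℚ.p⊓q≤p (side false) (side true)
  starCut≤side true  = ℚ.p⊓q≤q (side false) (side true)
  lower : ∀ W → W ∈ Separates n<N I → starCut J c I ℚ.≤ crossWeights (star J c) W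
  lower W sep =
    let (y , W≡) = separates⇒extend n<N I W sep
        side≡ = trans (sym (crossWeights-star J c I y)) (cong (crossWeights (star J c)) (sym W≡))
    in subst (starCut J c I ℚ.≤_) side≡ (starCut≤side y)
  attained : starCut J c I ≡ side false ⊎ starCut J c I ≡ side true →
    ∃[ W ] W ∈ Separates n<N I × crossWeights (star J c) W ≡ starCut J c I
  attained (inj₁ eq) = extend I false , separates-extend n<N I false , trans (crossWeights-star J c I false) (sym eq)
  attained (inj₂ eq) = extend I true  , separates-extend n<N I true  , trans (crossWeights-star J c I true) (sym eq)

starCut-realized : ∀ {n} (J : Subset n) {c} → 0ℚ ℚ.≤ c → (fromℚ ∘ starCut J c ∘ value) ∈ HolographicEntropyCone n
starCut-realized {n} J {c} 0≤c = 2 ℕ.+ n , n<N , starWeight J c 0≤c , λ I →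
  ≗⇒≈ (fromℚ (starCut J c (value I))) (minCut n<N (starWeight J c 0≤c) (value I))
    λ m → sym (seq-minCut-star n<N J c 0≤c (value I) m)
  where
  n<N : n ℕ.< 2 ℕ.+ n
  n<N = ℕ.m≤n+m (suc n) 1

-- The two hub-sink weights that isolate an indicator.

size : ∀ {n} → Subset n → ℚ
size []      = 0ℚ
size (b ∷ J) = bit b + size J

-- Each spoke is cut for exactly one of the two positions of the hub.
size-crossing : ∀ {n} (J I : Subset n) → size J ≡ crossing outside J I + crossing inside J I
size-crossing []      I             = refl
size-crossing (b ∷ J) (inside ∷ I)  = trans (cong (bit b +_) (size-crossing J I))
  (solve 3 (λ b p q → b :+ (p :+ q) := (b :+ p) :+ (con 0ℚ :+ q)) refl (bit b) (crossing outside J I) (crossing inside J I))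
  where open +-*-Solver
size-crossing (b ∷ J) (outside ∷ I) = trans (cong (bit b +_) (size-crossing J I))
  (solve 3 (λ b p q → b :+ (p :+ q) := (con 0ℚ :+ p) :+ (b :+ q)) refl (bit b) (crossing outside J I) (crossing inside J I))
  where open +-*-Solver

crossing-nonNegative : ∀ {n} y (J I : Subset n) → 0ℚ ℚ.≤ crossing y J I
crossing-nonNegative y []      I = ℚ.≤-refl
crossing-nonNegative y (b ∷ J) I =
  nonNegative-+ (if head I xor y then bit b else 0ℚ) (crossing y J (tail I))
    (if-nonNegative (head I xor y) (bit-nonNegative b)) (crossing-nonNegative y J (tail I))

size-nonNegative : ∀ {n} (J : Subset n) → 0ℚ ℚ.≤ size J
size-nonNegative []      = ℚ.≤-refl
size-nonNegative (b ∷ J) = nonNegative-+ (bit b) (size J) (bit-nonNegative b) (size-nonNegative J)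

p≤p+q : ∀ p q → 0ℚ ℚ.≤ q → p ℚ.≤ p + q
p≤p+q p q 0≤q = subst (ℚ._≤ p + q) (ℚ.+-identityʳ p) (ℚ.+-monoʳ-≤ p {0ℚ} {q} 0≤q)

q≤p+q : ∀ p q → 0ℚ ℚ.≤ p → q ℚ.≤ p + q
q≤p+q p q 0≤p = subst (ℚ._≤ p + q) (ℚ.+-identityˡ q) (ℚ.+-monoˡ-≤ q {0ℚ} {p} 0≤p)

1≤p⇒0≤p-1 : ∀ p → 1ℚ ℚ.≤ p → 0ℚ ℚ.≤ p - 1ℚ
1≤p⇒0≤p-1 p = ℚ.+-monoˡ-≤ (- 1ℚ) {1ℚ} {p}

1≤size : ∀ {n} (J : Subset n) → Nonempty J → 1ℚ ℚ.≤ size J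
1≤size (inside ∷ J) (zero  , _)   = p≤p+q 1ℚ (size J) (size-nonNegative J)
1≤size (b ∷ J)      (suc x , x∈J) =
  ℚ.≤-trans (1≤size J (x , drop-there x∈J)) (q≤p+q (bit b) (size J) (bit-nonNegative b))

-- The number of elements of `J` missing from `I` is an integer: either it is 0 and `J ⊆ I`, or it
-- is at least 1. This gap lets a change of the hub-sink weight by 1 detect containment.
containing-crossing : ∀ {n} (J I : Subset n) →
  (crossing inside J I ≡ 0ℚ × containing J I ≡ 1ℚ) ⊎ (1ℚ ℚ.≤ crossing inside J I × containing J I ≡ 0ℚ)
containing-crossing []      I = inj₁ (refl , refl)
containing-crossing (b ∷ J) (x ∷ I) = step b x (containing-crossing J I)
  where
  step : ∀ b x →
    (crossing inside J I ≡ 0ℚ × containing J I ≡ 1ℚ) ⊎ (1ℚ ℚ.≤ crossing inside J I × containing J I ≡ 0ℚ) →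
    (crossing inside (b ∷ J) (x ∷ I) ≡ 0ℚ × containing (b ∷ J) (x ∷ I) ≡ 1ℚ) ⊎
    (1ℚ ℚ.≤ crossing inside (b ∷ J) (x ∷ I) × containing (b ∷ J) (x ∷ I) ≡ 0ℚ)
  step inside  inside  (inj₁ (p , q)) = inj₁ (cong (0ℚ +_) p , cong (1ℚ *_) q)
  step outside inside  (inj₁ (p , q)) = inj₁ (cong (0ℚ +_) p , q)
  step outside outside (inj₁ (p , q)) = inj₁ (cong (0ℚ +_) p , q)
  step inside  outside _              =
    inj₂ (p≤p+q 1ℚ (crossing inside J I) (crossing-nonNegative inside J I) , ℚ.*-zeroˡ (containing J I))
  step inside  inside  (inj₂ (p , q)) =
    inj₂ (ℚ.≤-trans p (q≤p+q 0ℚ (crossing inside J I) ℚ.≤-refl) , cong (1ℚ *_) q)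
  step outside inside  (inj₂ (p , q)) =
    inj₂ (ℚ.≤-trans p (q≤p+q 0ℚ (crossing inside J I) ℚ.≤-refl) , q)
  step outside outside (inj₂ (p , q)) =
    inj₂ (ℚ.≤-trans p (q≤p+q 0ℚ (crossing inside J I) ℚ.≤-refl) , q)

min-left : ∀ p q r → 0ℚ ℚ.≤ r → q ≡ p + r → (p + 0ℚ) ⊓ q ≡ p
min-left p q r 0≤r refl = trans (ℚ.p≤q⇒p⊓q≡p (ℚ.+-monoʳ-≤ p {0ℚ} {r} 0≤r)) (ℚ.+-identityʳ p)

min-right : ∀ p q r → r ℚ.≤ 0ℚ → q ≡ p + r → (p + 0ℚ) ⊓ q ≡ p + r
min-right p q r r≤0 refl = ℚ.p≥q⇒p⊓q≡q (ℚ.+-monoʳ-≤ p {r} {0ℚ} r≤0)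

-- With `p` and `q` the two crossing numbers, moving the hub inside costs `q + (p + q) = p + 2q`,
-- which is never less than `p`.
starCut-size : ∀ {n} (J I : Subset n) → starCut J (size J) I ≡ crossing outside J I
starCut-size J I = min-left p (q + size J) (q + q) (nonNegative-+ q q 0≤q 0≤q)
  (trans (cong (q +_) (size-crossing J I)) (solve 2 (λ p q → q :+ (p :+ q) := p :+ (q :+ q)) refl p q))
  where
  open +-*-Solver
  p = crossing outside J I
  q = crossing inside J I
  0≤q = crossing-nonNegative inside J I

-- Moving the hub inside now costs `p + (2q - 1)`. This beats `p`, by exactly 1, when `q = 0`; once
-- `q` is at least 1 it does not.
starCut-size-1 : ∀ {n} (J I : Subset n) → starCut J (size J - 1ℚ) I ≡ crossing outside J I - containing J I
starCut-size-1 J I = go (containing-crossing J I)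
  where
  open +-*-Solver
  p = crossing outside J I
  q = crossing inside J I
  regroup : q + (size J - 1ℚ) ≡ p + (q + (q - 1ℚ))
  regroup = trans (cong (λ s → q + (s - 1ℚ)) (size-crossing J I))
    (solve 2 (λ p q → q :+ ((p :+ q) :- con 1ℚ) := p :+ (q :+ (q :- con 1ℚ))) refl p q)
  go : (q ≡ 0ℚ × containing J I ≡ 1ℚ) ⊎ (1ℚ ℚ.≤ q × containing J I ≡ 0ℚ) →
       starCut J (size J - 1ℚ) I ≡ p - containing J I
  go (inj₁ (q≡0 , χ≡1)) = trans
    (min-right p (q + (size J - 1ℚ)) (- 1ℚ) (ℚ.<⇒≤ (ℚ.negative⁻¹ (- 1ℚ)))
      (trans regroup (cong (λ q → p + (q + (q - 1ℚ))) q≡0)))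
    (cong (λ χ → p - χ) (sym χ≡1))
  go (inj₂ (1≤q , χ≡0)) = trans
    (min-left p (q + (size J - 1ℚ)) (q + (q - 1ℚ))
      (nonNegative-+ q (q - 1ℚ) (crossing-nonNegative inside J I) (1≤p⇒0≤p-1 q 1≤q)) regroup)
    (trans (sym (ℚ.+-identityʳ p)) (cong (λ χ → p - χ) (sym χ≡0)))

RationalSpan-member : ∀ {X : Set} {A : Pred (X → ℝ) 0ℓ} f → (fromℚ ∘ f) ∈ A → f ∈ RationalSpan A
RationalSpan-member f f∈A = 1 , (λ _ → 1ℚ) , (λ _ → f) , (λ _ → f∈A) , λ x →
  sym (trans (ℚ.+-identityʳ (1ℚ * f x)) (ℚ.*-identityˡ (f x)))

-- The indicator is the difference of the two realized vectors. Nonemptiness of `J` makes the second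
-- hub-sink weight, `size J - 1ℚ`, nonnegative.
containing∈RationalSpan : ∀ {n} (J : Subset n) → Nonempty J →
  (containing J ∘ value) ∈ RationalSpan (HolographicEntropyCone n)
containing∈RationalSpan {n} J nonempty =
  RationalSpan-difference {A = HolographicEntropyCone n}
    (RationalSpan-member {A = HolographicEntropyCone n} (starCut J (size J) ∘ value) (starCut-realized J (size-nonNegative J)))
    (RationalSpan-member {A = HolographicEntropyCone n} (starCut J (size J - 1ℚ) ∘ value) (starCut-realized J (1≤p⇒0≤p-1 (size J) (1≤size J nonempty))))
    λ I → trans
      (solve 2 (λ p χ → χ := p :- (p :- χ)) refl (crossing outside J (value I)) (containing J (value I)))
      (sym (cong₂ _-_ (starCut-size J (value I)) (starCut-size-1 J (value I))))
  where open +-*-Solver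

equalling∈RationalSpan : ∀ {n} (K : Subset n) → Nonempty K →
  (equalling K ∘ value) ∈ RationalSpan (HolographicEntropyCone n)
equalling∈RationalSpan {n} K (x , x∈K) =
  möbius (λ f → (f ∘ value) ∈ RationalSpan (HolographicEntropyCone n))
    (λ f∈ g∈ h≗ → RationalSpan-difference {A = HolographicEntropyCone n} f∈ g∈ (h≗ ∘ value))
    -- Only supersets of `K` enter the inversion, and they inherit the element `x` that witnesses
    -- nonemptiness.
    K (λ J K⊆J → containing∈RationalSpan J (x , K⊆J x∈K))

-- Counting the nonempty subsets.

bit-code : Bool → Fin 2
bit-code = Inverse.from 2↔Bool

code : ∀ {n} → Subset n → Fin (2 ^ n)
code []      = zero
code (b ∷ I) = combine (bit-code b) (code I)

decode : ∀ n → Fin (2 ^ n) → Subset n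
decode zero    _ = []
decode (suc n) k = let (b , i) = remQuot (2 ^ n) k in Inverse.to 2↔Bool b ∷ decode n i

decode-code : ∀ {n} (I : Subset n) → decode n (code I) ≡ I
decode-code []      = refl
decode-code {suc n} (b ∷ I) = trans
  (cong (λ (c , i) → Inverse.to 2↔Bool c ∷ decode n i) (remQuot-combine (bit-code b) (code I)))
  (cong₂ _∷_ (Inverse.strictlyInverseˡ 2↔Bool b) (decode-code I))

code-decode : ∀ n k → code (decode n k) ≡ k
code-decode zero    zero = refl
code-decode (suc n) k    = trans
  (cong₂ combine (Inverse.strictlyInverseʳ 2↔Bool (proj₁ (remQuot {2} (2 ^ n) k)))
                 (code-decode n (proj₂ (remQuot {2} (2 ^ n) k))))
  (combine-remQuot {2} (2 ^ n) k)

-- The stored proof is irrelevant, so a usable witness is recomputed by deciding nonemptiness.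
value-nonempty : ∀ {n} (I : NonemptySubset n) → Nonempty (value I)
value-nonempty (I ,ᵣ [ nonempty ]) = recompute (nonempty? I) nonempty

Enumeration : ℕ → ℕ → Set
Enumeration n d = Σ[ e ∈ (Fin d → NonemptySubset n) ]
  (∀ i j → value (e i) ≡ value (e j) → i ≡ j) × (∀ I → ∃[ i ] e i ≡ I)

enumeration : ∀ n → Enumeration n (2 ^ n ∸ 1)
enumeration n = from-code (2 ^ n) code (decode n) decode-code (code-decode n)
  where
  -- Generalising `2 ^ n` to a variable allows matching on `suc d`, after which `suc d ∸ 1` reduces
  -- to `d`, the number of codes other than that of `⊥`.
  from-code : ∀ d (code : Subset n → Fin d) (decode : Fin d → Subset n) →
    (∀ I → decode (code I) ≡ I) → (∀ k → code (decode k) ≡ k) → Enumeration n (d ∸ 1)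
  from-code zero    code decode decode-code code-decode with () ← code ⊥
  from-code (suc d) code decode decode-code code-decode = e , e-injective , e-surjective
    where
    subset : Fin d → Subset n
    -- `punchIn` skips the code of the empty set.
    subset i = decode (punchIn (code ⊥) i)
    subset-nonempty : ∀ i → Nonempty (subset i)
    subset-nonempty i with nonempty? (subset i)
    ... | yes nonempty = nonempty
    ... | no  empty    = contradiction
      (trans (sym (code-decode _)) (cong code (Empty-unique empty))) (punchInᵢ≢i (code ⊥) i)
    e : Fin d → NonemptySubset n
    e i = subset i ,ᵣ [ subset-nonempty i ]
    e-injective : ∀ i j → value (e i) ≡ value (e j) → i ≡ j
    e-injective i j eq = punchIn-injective (code ⊥) i j
      (trans (sym (code-decode _)) (trans (cong code eq) (code-decode _)))
    e-surjective : ∀ I → ∃[ i ] e i ≡ I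
    e-surjective I′@(I ,ᵣ _) = punchOut ⊥≢I , value-injective
      (trans (cong decode (punchIn-punchOut ⊥≢I)) (decode-code I))
      where
      ⊥≢I : code ⊥ ≢ code I
      ⊥≢I eq = let (x , x∈I) = value-nonempty I′ in
        ∉⊥ (subst (x ∈ₛ_) (trans (sym (decode-code I)) (trans (cong decode (sym eq)) (decode-code ⊥))) x∈I)

-- The standard basis and the dimension.

sum-equalling : ∀ {n d} (((e , _)) : Enumeration n d) (c : Fin d → ℚ) i →
  sumℚ (λ j → c j * equalling (value (e j)) (value (e i))) ≡ c i
sum-equalling (e , e-injective , _) c i = begin
  sumℚ (λ j → c j * equalling (value (e j)) (value (e i)))
    ≡⟨ sum-single (λ j → c j * equalling (value (e j)) (value (e i))) i (λ j j≢i →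
         trans (cong (c j *_) (equalling-≢ (value (e j)) (value (e i)) (j≢i ∘ e-injective j i))) (ℚ.*-zeroʳ (c j))) ⟩
  c i * equalling (value (e i)) (value (e i))   ≡⟨ cong (c i *_) (equalling-refl (value (e i))) ⟩
  c i * 1ℚ                                      ≡⟨ ℚ.*-identityʳ (c i) ⟩
  c i                                           ∎
  where open ≡-Reasoning

-- The indicators of single sets form the standard basis, so evaluating a combination at `e i`
-- returns its coefficient `c i`. Both independence and spanning follow from this.
holographicEntropyCone-hasDimension : ∀ {n d} → Enumeration n d → HasDimension (HolographicEntropyCone n) d
holographicEntropyCone-hasDimension {n} {d} enum@(e , _ , e-surjective) = b , b∈Span , independent , spanning
  where
  b : Fin d → EntropyVector n
  b j = fromℚ ∘ equalling (value (e j)) ∘ value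

  b∈Span : ∀ j → b j ∈ Span (HolographicEntropyCone n)
  b∈Span j = RationalSpan⇒Span {A = HolographicEntropyCone n} (equalling∈RationalSpan (value (e j)) (value-nonempty (e j)))

  seq-combination : ∀ c i m → seq (linearCombination c b (e i)) m ≡ seq (c i) m
  seq-combination c i m = trans (seq-sum (λ j → c j *ᵣ b j (e i)) m) (sum-equalling enum (λ j → seq (c j) m) i)

  independent : LinearlyIndependent b
  independent c c≋𝟘 i ε 0<ε =
    let (M , close) = c≋𝟘 (e i) ε 0<ε
    in M , λ m M≤m → subst (λ p → ∣ p - 0ℚ ∣ ℚ.< ε) (seq-combination c i m) (close m M≤m)

  spanning : ∀ v → v ∈ Span (HolographicEntropyCone n) → ∃[ c ] v ≋ linearCombination c b
  -- The coefficients of `v` are its own entries, listed along the enumeration.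
  spanning v _ = v ∘ e , λ I →
    let (i , ei≡I) = e-surjective I
    in subst (λ I → v I ≈ᵣ linearCombination (v ∘ e) b I) ei≡I
         (≗⇒≈ (v (e i)) (linearCombination (v ∘ e) b (e i)) λ m → sym (seq-combination (v ∘ e) i m))

proposition1 : (n : ℕ) → 1 ≤ n →
    IsCone (HolographicEntropyCone n) ×
    HasDimension (HolographicEntropyCone n) (2 ^ n ∸ 1)
proposition1 n _ = holographicEntropyCone-isCone n , holographicEntropyCone-hasDimension (enumeration n)
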